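{- For any integer $k\geq 1$, there exists no simple graph $G$ such that $\mathrm{Jac}(G)\cong (\mathbb{Z}/2\mathbb{Z})^k$ as groups.
   Context: A graph is a finite connected graph, possibly with multiple edges, but without loops; a simple graph is a graph without multiple edges. A divisor on $G$ is a formal integral combination $D=\sum_{v\in V(G)} D(v)v$, of degree $\sum_v D(v)$. For $f: V(G)\to\mathbb{Z}$ put $\mathrm{div}(f)=\sum_{v}\big(\sum_{e=vw}(f(v)-f(w))\big)v$, the inner sum being over edges $e$ containing $v$ (counted with multiplicity). The Jacobian $\mathrm{Jac}(G)$ is the (finite) group of degree-zero divisors modulo the subgroup of divisors of the form $\mathrm{div}(f)$. -}

module Defs where

open import Algebra.Bundles using (AbelianGroup)
import Algebra.Construct.Pointwise as Pointwise
open import Algebra.Morphism.Structures using (module GroupMorphisms)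
import Algebra.Properties.CommutativeMonoid.Sum as CMSum
open import Data.Fin.Base using (Fin; zero; suc)
open import Data.Integer.Base using (ℤ; +_; _+_; _-_; _*_; -_; 0ℤ)
import Data.Integer.Properties as ℤ
open import Data.Integer.Tactic.RingSolver using (solve-∀)
open import Data.Nat.Base as ℕ using (ℕ; zero; suc; NonZero)
import Data.Parity.Properties as ℙ
open import Data.Product.Base using (Σ-syntax; ∃-syntax; _,_; proj₁)
open import Level using (0ℓ)
open import Relation.Binary.Construct.Closure.ReflexiveTransitive using (Star)
open import Relation.Binary.PropositionalEquality
  using (_≡_; refl; sym; trans; cong; cong₂)

open CMSum ℤ.+-0-commutativeMonoid
  using (sum; sum-syntax; sum-cong-≗; sum-replicate-zero; ∑-distrib-+)

-- A finite connected loopless multigraph on the vertex set Fin order,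
-- given by the number `mult v w` of edges joining v and w.
record Graph : Set where
  field
    order     : ℕ
    nonEmpty  : NonZero order
    mult      : Fin order → Fin order → ℕ
    symmetric : ∀ v w → mult v w ≡ mult w v
    loopless  : ∀ v → mult v v ≡ 0

  Vertex : Set
  Vertex = Fin order

  Adjacent : Vertex → Vertex → Set
  Adjacent v w = 0 ℕ.< mult v w

  field
    connected : ∀ v w → Star Adjacent v w

open Graph using (Vertex)

IsSimple : Graph → Set
IsSimple G = ∀ v w → Graph.mult G v w ℕ.≤ 1

sum-neg : ∀ {n} (f : Fin n → ℤ) → sum (λ i → - f i) ≡ - sum f
sum-neg {zero}  f = refl
sum-neg {suc n} f = trans (cong (λ s → - f zero + s) (sum-neg (λ i → f (suc i))))
                          (sym (ℤ.neg-distrib-+ (f zero) _))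

module _ (G : Graph) where
  open Graph G using (order; mult)

  Divisor : Set
  Divisor = Vertex G → ℤ

  degree : Divisor → ℤ
  degree D = ∑[ v < order ] D v

  -- The sum over the edges e = vw containing v, grouped by the other end w.
  div : (Vertex G → ℤ) → Divisor
  div f v = ∑[ w < order ] (+ mult v w * (f v - f w))

  div-0 : ∀ v → div (λ _ → 0ℤ) v ≡ 0ℤ
  div-0 v = trans (sum-cong-≗ (λ w → ℤ.*-zeroʳ (+ mult v w)))
                  (sum-replicate-zero order)

  div-neg : ∀ f v → div (λ w → - f w) v ≡ - div f v
  div-neg f v = trans (sum-cong-≗ (λ w → lemma (+ mult v w) (f v) (f w)))
                      (sum-neg (λ w → + mult v w * (f v - f w)))
    where
    lemma : ∀ m a b → m * (- a - - b) ≡ - (m * (a - b))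
    lemma = solve-∀

  div-+ : ∀ f g v → div (λ w → f w + g w) v ≡ div f v + div g v
  div-+ f g v = trans
    (sum-cong-≗ (λ w → lemma (+ mult v w) (f v) (f w) (g v) (g w)))
    (∑-distrib-+ (λ w → + mult v w * (f v - f w)) (λ w → + mult v w * (g v - g w)))
    where
    lemma : ∀ m a b c d → m * ((a + c) - (b + d)) ≡ m * (a - b) + m * (c - d)
    lemma = solve-∀

  Divisor⁰ : Set
  Divisor⁰ = Σ[ D ∈ Divisor ] degree D ≡ 0ℤ

  -- Congruence modulo the subgroup of divisors of the form div f.
  infix 4 _∼_
  _∼_ : Divisor⁰ → Divisor⁰ → Set
  (D , _) ∼ (E , _) = ∃[ f ] ∀ v → D v - E v ≡ div f v

  infixl 6 _⊕_
  _⊕_ : Divisor⁰ → Divisor⁰ → Divisor⁰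
  (D , d) ⊕ (E , e) = (λ v → D v + E v) , trans (∑-distrib-+ D E) (cong₂ _+_ d e)

  ⊖_ : Divisor⁰ → Divisor⁰
  ⊖ (D , d) = (λ v → - D v) , trans (sum-neg D) (cong -_ d)

  𝟘 : Divisor⁰
  𝟘 = (λ _ → 0ℤ) , sum-replicate-zero order

  ≗⇒∼ : ∀ {D E} → (∀ v → proj₁ D v ≡ proj₁ E v) → D ∼ E
  ≗⇒∼ D≗E = (λ _ → 0ℤ) , λ v → trans (ℤ.i≡j⇒i-j≡0 (D≗E v)) (sym (div-0 v))

  ∼-refl : ∀ {D} → D ∼ D
  ∼-refl {D} = ≗⇒∼ {D} {D} (λ _ → refl)

  ∼-sym : ∀ {D E} → D ∼ E → E ∼ D
  ∼-sym {D , _} {E , _} (f , p) = (λ v → - f v) , λ v →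
    trans (lemma (D v) (E v)) (trans (cong -_ (p v)) (sym (div-neg f v)))
    where
    lemma : ∀ a b → b - a ≡ - (a - b)
    lemma = solve-∀

  ∼-trans : ∀ {D E F} → D ∼ E → E ∼ F → D ∼ F
  ∼-trans {D , _} {E , _} {F , _} (f , p) (g , q) = (λ v → f v + g v) , λ v →
    trans (lemma (D v) (E v) (F v)) (trans (cong₂ _+_ (p v) (q v)) (sym (div-+ f g v)))
    where
    lemma : ∀ a b c → a - c ≡ (a - b) + (b - c)
    lemma = solve-∀

  ⊕-cong : ∀ {D D′ E E′} → D ∼ D′ → E ∼ E′ → D ⊕ E ∼ D′ ⊕ E′
  ⊕-cong {D , _} {D′ , _} {E , _} {E′ , _} (f , p) (g , q) = (λ v → f v + g v) , λ v →
    trans (lemma (D v) (D′ v) (E v) (E′ v))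
          (trans (cong₂ _+_ (p v) (q v)) (sym (div-+ f g v)))
    where
    lemma : ∀ a a′ b b′ → (a + b) - (a′ + b′) ≡ (a - a′) + (b - b′)
    lemma = solve-∀

  ⊖-cong : ∀ {D E} → D ∼ E → ⊖ D ∼ ⊖ E
  ⊖-cong {D , _} {E , _} (f , p) = (λ v → - f v) , λ v →
    trans (lemma (D v) (E v)) (trans (cong -_ (p v)) (sym (div-neg f v)))
    where
    lemma : ∀ a b → - a - - b ≡ - (a - b)
    lemma = solve-∀

  Jac : AbelianGroup 0ℓ 0ℓ
  Jac = record
    { Carrier = Divisor⁰
    ; _≈_     = _∼_
    ; _∙_     = _⊕_
    ; ε       = 𝟘
    ; _⁻¹     = ⊖_
    ; isAbelianGroup = record
      { isGroup = record
        { isMonoid = record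
          { isSemigroup = record
            { isMagma = record
              { isEquivalence = record
                { refl  = λ {D} → ∼-refl {D}
                ; sym   = λ {D} {E} → ∼-sym {D} {E}
                ; trans = λ {D} {E} {F} → ∼-trans {D} {E} {F}
                }
              ; ∙-cong = λ {D} {D′} {E} {E′} → ⊕-cong {D} {D′} {E} {E′}
              }
            ; assoc = λ D E F → ≗⇒∼ {(D ⊕ E) ⊕ F} {D ⊕ (E ⊕ F)}
                (λ v → ℤ.+-assoc (proj₁ D v) (proj₁ E v) (proj₁ F v))
            }
          ; identity = (λ D → ≗⇒∼ {𝟘 ⊕ D} {D} (λ v → ℤ.+-identityˡ (proj₁ D v)))
                     , (λ D → ≗⇒∼ {D ⊕ 𝟘} {D} (λ v → ℤ.+-identityʳ (proj₁ D v)))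
          }
        ; inverse = (λ D → ≗⇒∼ {⊖ D ⊕ D} {𝟘} (λ v → ℤ.+-inverseˡ (proj₁ D v)))
                  , (λ D → ≗⇒∼ {D ⊕ ⊖ D} {𝟘} (λ v → ℤ.+-inverseʳ (proj₁ D v)))
        ; ⁻¹-cong = λ {D} {E} → ⊖-cong {D} {E}
        }
      ; comm = λ D E → ≗⇒∼ {D ⊕ E} {E ⊕ D} (λ v → ℤ.+-comm (proj₁ D v) (proj₁ E v))
      }
    }

[ℤ/2ℤ]^_ : ℕ → AbelianGroup 0ℓ 0ℓ
[ℤ/2ℤ]^ k = Pointwise.abelianGroup (Fin k) ℙ.+-0-abelianGroup

infix 4 _≅_
_≅_ : AbelianGroup 0ℓ 0ℓ → AbelianGroup 0ℓ 0ℓ → Set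
A ≅ B = ∃[ φ ] IsGroupIsomorphism φ
  where open GroupMorphisms (AbelianGroup.rawGroup A) (AbelianGroup.rawGroup B)

{-# OPTIONS --safe #-}

-- For an edge vw, if 2(v − w) = div f then f is maximal at v and minimal at w,
-- and its drops along the edges at v add up to 2. If f also dropped along an
-- edge vx with x ≠ w, then either f(x) = f(w), and minimality spreads from x
-- to v, or f(w) < f(x) < f(v), and the drops at v add up to at least 3. As vw
-- is a simple edge, it is the only edge leaving the set where f is maximal,
-- and v − w is the divisor of the indicator function of that set. So adjacent
-- vertices are equivalent, and connectedness makes the Jacobian trivial.
module Submission where

open import Defs
open import Algebra.Bundles using (AbelianGroup)
open import Algebra.Morphism.Structures using (module GroupMorphisms)
import Algebra.Properties.Semiring.Sum as SemiringSum
open import Data.Bool.Base using (if_then_else_)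
open import Data.Fin.Base using (Fin; zero; suc; punchOut; fromℕ<)
open import Data.Fin.Properties using (_≟_; punchIn-punchOut)
open import Data.Integer.Base as ℤ
  using (ℤ; +_; 0ℤ; 1ℤ; _+_; _-_; _*_; -_; +≤+)
import Data.Integer.Properties as ℤ
open import Data.Integer.Tactic.RingSolver using (solve-∀)
open import Data.List.Base using (allFin)
import Data.List.Extrema as Extrema
open import Data.List.Membership.Propositional.Properties using (∈-allFin)
import Data.List.Relation.Unary.All as All
open import Data.Nat.Base as ℕ using (ℕ; suc; _≤_; z≤n; s≤s)
import Data.Nat.Properties as ℕ
open import Data.Parity.Base using (0ℙ; 1ℙ)
import Data.Parity.Properties as ℙ
open import Data.Product.Base using (∃-syntax; _×_; _,_; proj₁; proj₂)
open import Data.Vec.Functional using (removeAt)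
open import Function.Base using (_∘_)
open import Relation.Binary.Construct.Closure.ReflexiveTransitive using (Star; _◅_)
open import Relation.Binary.PropositionalEquality
  using (_≡_; _≢_; refl; sym; trans; cong; cong₂; subst; ≢-sym; module ≡-Reasoning)
open import Relation.Nullary.Decidable.Core using (does; yes; no)
open import Relation.Nullary.Negation.Core using (¬_; contradiction)

open Extrema ℤ.≤-totalOrder using (argmax; f[xs]≤f[argmax])
open SemiringSum ℤ.+-*-semiring
  using (sum; sum-syntax; sum-cong-≗; sum-replicate-zero; sum-remove
        ; ∑-distrib-+; *-distribˡ-sum)

-- Sums of nonnegative integers

0≤sum : ∀ {n} {t : Fin n → ℤ} → (∀ i → 0ℤ ℤ.≤ t i) → 0ℤ ℤ.≤ sum t
0≤sum {ℕ.zero} 0≤t = ℤ.≤-refl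
0≤sum {suc n}  0≤t = ℤ.+-mono-≤ (0≤t zero) (0≤sum (0≤t ∘ suc))

term≤sum : ∀ {n} {t : Fin n → ℤ} → (∀ i → 0ℤ ℤ.≤ t i) → ∀ i → t i ℤ.≤ sum t
term≤sum {suc n} {t} 0≤t i = begin
  t i                       ≡⟨ ℤ.+-identityʳ (t i) ⟨
  t i + 0ℤ                  ≤⟨ ℤ.+-monoʳ-≤ (t i) (0≤sum {t = removeAt t i} (λ _ → 0≤t _)) ⟩
  t i + sum (removeAt t i)  ≡⟨ sum-remove t ⟨
  sum t                     ∎
  where open ℤ.≤-Reasoning

two-terms≤sum : ∀ {n} {t : Fin n → ℤ} → (∀ i → 0ℤ ℤ.≤ t i) →
                ∀ {i j} → i ≢ j → t i + t j ℤ.≤ sum t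
two-terms≤sum {suc n} {t} 0≤t {i} {j} i≢j = begin
  t i + t j                           ≡⟨ cong (λ k → t i + t k) (punchIn-punchOut i≢j) ⟨
  t i + removeAt t i (punchOut i≢j)   ≤⟨ ℤ.+-monoʳ-≤ (t i) (term≤sum {t = removeAt t i} (λ _ → 0≤t _) (punchOut i≢j)) ⟩
  t i + sum (removeAt t i)            ≡⟨ sum-remove t ⟨
  sum t                               ∎
  where open ℤ.≤-Reasoning

-- Indicators of single vertices

δ : ∀ {n} → Fin n → Fin n → ℤ
δ u v = if does (u ≟ v) then 1ℤ else 0ℤ

δ-same : ∀ {n} (u : Fin n) → δ u u ≡ 1ℤ
δ-same u with u ≟ u
... | yes _  = refl
... | no u≢u = contradiction refl u≢u

δ-distinct : ∀ {n} (u v : Fin n) → u ≢ v → δ u v ≡ 0ℤ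
δ-distinct u v u≢v with u ≟ v
... | yes u≡v = contradiction u≡v u≢v
... | no _    = refl

0≤δ : ∀ {n} (u v : Fin n) → 0ℤ ℤ.≤ δ u v
0≤δ u v with u ≟ v
... | yes _ = +≤+ z≤n
... | no _  = +≤+ z≤n

δ-sym : ∀ {n} (u v : Fin n) → δ u v ≡ δ v u
δ-sym u v with u ≟ v
... | yes refl = sym (δ-same u)
... | no u≢v   = sym (δ-distinct v u (≢-sym u≢v))

∑-select : ∀ {n} (f : Fin n → ℤ) u → ∑[ v < n ] (f v * δ u v) ≡ f u
∑-select {suc n} f zero = trans
  (cong₂ _+_ (ℤ.*-identityʳ (f zero))
    (trans (sum-cong-≗ (λ v → ℤ.*-zeroʳ (f (suc v)))) (sum-replicate-zero n)))
  (ℤ.+-identityʳ (f zero))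
-- `δ (suc u) (suc v)` reduces to `δ u v`, because `does` commutes definitionally with the successor
-- case of `_≟_`, so the induction hypothesis fits as it stands.
∑-select {suc n} f (suc u) = trans
  (cong₂ _+_ (ℤ.*-zeroʳ (f zero)) (∑-select (f ∘ suc) u))
  (ℤ.+-identityˡ (f (suc u)))

∑-δ-difference : ∀ {n} a b (v w : Fin n) → ∑[ x < n ] (a * δ v x + - b * δ w x) ≡ a - b
∑-δ-difference a b v w = trans
  (∑-distrib-+ (λ x → a * δ v x) (λ x → - b * δ w x))
  (cong₂ _+_ (∑-select (λ _ → a) v) (∑-select (λ _ → - b) w))

-- Functions on a graph near their maxima

module _ (G : Graph) where
  open Graph G

  IsMax : (Vertex → ℤ) → Vertex → Set
  IsMax f v = ∀ u → f u ℤ.≤ f v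

  isMax-≥ : ∀ {f u v} → IsMax f v → f v ℤ.≤ f u → IsMax f u
  isMax-≥ v-max fv≤fu x = ℤ.≤-trans (v-max x) fv≤fu

  ∃-max : (f : Vertex → ℤ) → Vertex → ∃[ m ] IsMax f m
  ∃-max f v = argmax f v (allFin order) ,
    λ u → All.lookup (f[xs]≤f[argmax] {f = f} v (allFin order)) (∈-allFin u)

  module _ {f : Vertex → ℤ} {u : Vertex} (u-max : IsMax f u) where

    0≤drop : ∀ x → 0ℤ ℤ.≤ + mult u x * (f u - f x)
    0≤drop x = subst (ℤ._≤ + mult u x * (f u - f x)) (ℤ.*-zeroʳ (+ mult u x))
      (ℤ.*-monoˡ-≤-nonNeg (+ mult u x) (ℤ.i≤j⇒0≤j-i (u-max x)))

    0≤div : 0ℤ ℤ.≤ div G f u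
    0≤div = 0≤sum 0≤drop

    difference≤drop : ∀ {x} → Adjacent u x → f u - f x ℤ.≤ + mult u x * (f u - f x)
    difference≤drop {x} u~x = subst (ℤ._≤ + mult u x * (f u - f x)) (ℤ.*-identityˡ (f u - f x))
      (ℤ.*-monoʳ-≤-nonNeg (f u - f x)
        {{ℤ.nonNegative (ℤ.i≤j⇒0≤j-i (u-max x))}} (+≤+ u~x))

    two-differences≤div : ∀ {x y} → x ≢ y → Adjacent u x → Adjacent u y →
                          (f u - f x) + (f u - f y) ℤ.≤ div G f u
    two-differences≤div x≢y u~x u~y = ℤ.≤-trans
      (ℤ.+-mono-≤ (difference≤drop u~x) (difference≤drop u~y))
      (two-terms≤sum 0≤drop x≢y)

    -- At a maximum no drop is negative, so each is bounded by their total. A total of at most 0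
    -- leaves no drop along any edge, and the neighbour has the same value.
    max-spreads : div G f u ℤ.≤ 0ℤ → ∀ {x} → Adjacent u x → IsMax f x
    max-spreads div≤0 {x} u~x = isMax-≥ u-max (ℤ.i-j≤0⇒i≤j
      (ℤ.≤-trans (difference≤drop u~x) (ℤ.≤-trans (term≤sum 0≤drop x) div≤0)))

  -- Functions whose divisor is twice a difference of two vertices

  record Dipole (v w : Vertex) (f : Vertex → ℤ) : Set where
    constructor mkDipole
    field
      dipole-div : ∀ u → + 2 * (δ v u - δ w u) ≡ div G f u

  open Dipole

  -- This symmetry lets minima be treated as maxima of the negated function, with source and sink
  -- exchanged.
  dipole-neg : ∀ {v w f} → Dipole v w f → Dipole w v (-_ ∘ f)
  dipole-neg {v} {w} {f} dip = mkDipole λ u →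
    trans (lemma (δ w u) (δ v u)) (trans (cong -_ (dipole-div dip u)) (sym (div-neg G f u)))
    where
    lemma : ∀ a b → + 2 * (a - b) ≡ - (+ 2 * (b - a))
    lemma = solve-∀

  module _ {v w f} (dip : Dipole v w f) where

    div≤0 : ∀ {u} → u ≢ v → div G f u ℤ.≤ 0ℤ
    div≤0 {u} u≢v = subst (ℤ._≤ 0ℤ) (dipole-div dip u) (ℤ.*-monoˡ-≤-nonNeg (+ 2)
      (ℤ.i≤j⇒i-j≤0 (subst (ℤ._≤ δ w u) (sym (δ-distinct v u (≢-sym u≢v))) (0≤δ w u))))

    -- The divisor is -2 at the sink, but it is nonnegative at any maximum.
    sink-¬max : v ≢ w → ¬ IsMax f w
    sink-¬max v≢w w-max = contradiction 0≤-2 λ ()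
      where
      0≤-2 : 0ℤ ℤ.≤ + 2 * (0ℤ - 1ℤ)
      0≤-2 = subst (0ℤ ℤ.≤_)
        (trans (sym (dipole-div dip w)) (cong₂ (λ a b → + 2 * (a - b)) (δ-distinct v w v≢w) (δ-same w)))
        (0≤div w-max)

    -- If `f v` lay below the maximal value, no maximum would be `v`, so the divisor would be at
    -- most 0 at every maximum. Maximality would then spread along a path from `m` to the sink.
    source-max : v ≢ w → IsMax f v
    source-max v≢w with ∃-max f v
    ... | m , m-max with f v ℤ.≟ f m
    ...   | yes fv≡fm = isMax-≥ m-max (ℤ.≤-reflexive (sym fv≡fm))
    ...   | no fv≢fm  = contradiction (reach m-max (connected m w)) (sink-¬max v≢w)
      where
      reach : ∀ {u x} → IsMax f u → Star Adjacent u x → IsMax f x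
      reach u-max Star.ε           = u-max
      reach {u} u-max (u~y ◅ path) =
        reach (max-spreads u-max (div≤0 u≢v) u~y) path
        where
        u≢v : u ≢ v
        u≢v refl = fv≢fm (ℤ.≤-antisym (m-max v) (u-max m))

  adjacent⇒distinct : ∀ {v w} → Adjacent v w → v ≢ w
  adjacent⇒distinct {v} v~v refl = ℕ.n≮0 (subst (0 ℕ.<_) (loopless v) v~v)

  adjacent-sym : ∀ {v w} → Adjacent v w → Adjacent w v
  adjacent-sym {v} {w} = subst (0 ℕ.<_) (symmetric v w)

  -- Dipoles along an edge

  module _ {v w f} (dip : Dipole v w f) (v~w : Adjacent v w) where
    private
      v≢w : v ≢ w
      v≢w = adjacent⇒distinct v~w

      v-max : IsMax f v
      v-max = source-max dip v≢w

      w-min : IsMax (-_ ∘ f) w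
      w-min = source-max (dipole-neg dip) (≢-sym v≢w)

    source-above-sink : f w ≢ f v
    source-above-sink fw≡fv = sink-¬max dip v≢w (isMax-≥ v-max (ℤ.≤-reflexive (sym fw≡fv)))

    -- Otherwise `x` is a second minimum, away from the sink, and minimality spreads along the edge
    -- to `v`, which is the sink of the negated dipole.
    above-sink : ∀ {x} → x ≢ w → Adjacent x v → f w ℤ.< f x
    above-sink {x} x≢w x~v = ℤ.≰⇒> λ fx≤fw →
      sink-¬max (dipole-neg dip) (≢-sym v≢w)
        (max-spreads (isMax-≥ w-min (ℤ.neg-mono-≤ fx≤fw)) (div≤0 (dipole-neg dip) x≢w) x~v)

    -- Integrality decides: a value strictly between `f w` and `f v` makes the drop along `vx` at
    -- least 1 and the drop along `vw` at least 2, while the divisor at `v` is only 2.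
    no-other-drop : ∀ {x} → x ≢ w → Adjacent v x → f x ≡ f v
    no-other-drop {x} x≢w v~x with f x ℤ.≟ f v
    ... | yes fx≡fv = fx≡fv
    ... | no fx≢fv  = contradiction 3≤2 λ { (+≤+ (s≤s (s≤s ()))) }
      where
      open ℤ.≤-Reasoning
      a<b⇒1≤b-a : ∀ {a b} → a ℤ.< b → 1ℤ ℤ.≤ b - a
      a<b⇒1≤b-a {a} {b} a<b = begin
        1ℤ             ≡⟨ lemma a ⟩
        1ℤ + a - a     ≤⟨ ℤ.+-monoˡ-≤ (- a) (ℤ.i<j⇒suc[i]≤j a<b) ⟩
        b - a          ∎
        where
        lemma : ∀ a → 1ℤ ≡ 1ℤ + a - a
        lemma = solve-∀
      1≤fv-fx : 1ℤ ℤ.≤ f v - f x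
      1≤fv-fx = a<b⇒1≤b-a (ℤ.≤∧≢⇒< (v-max x) fx≢fv)
      1≤fx-fw : 1ℤ ℤ.≤ f x - f w
      1≤fx-fw = a<b⇒1≤b-a (above-sink x≢w (adjacent-sym v~x))
      lemma : ∀ a b c → (a - b) + ((a - b) + (b - c)) ≡ (a - b) + (a - c)
      lemma = solve-∀
      3≤2 : + 3 ℤ.≤ + 2
      3≤2 = begin
        + 3                                          ≤⟨ ℤ.+-mono-≤ 1≤fv-fx (ℤ.+-mono-≤ 1≤fv-fx 1≤fx-fw) ⟩
        (f v - f x) + ((f v - f x) + (f x - f w))    ≡⟨ lemma (f v) (f x) (f w) ⟩
        (f v - f x) + (f v - f w)                    ≤⟨ two-differences≤div v-max x≢w v~x v~w ⟩
        div G f v                                    ≡⟨ dipole-div dip v ⟨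
        + 2 * (δ v v - δ w v)                        ≡⟨ cong₂ (λ a b → + 2 * (a - b)) (δ-same v) (δ-distinct w v (≢-sym v≢w)) ⟩
        + 2                                          ∎

    -- A maximum other than `v` passes its value to all its neighbours, and `v` passes it to all but
    -- `w`.
    only-drop : ∀ {u x} → f u ≡ f v → f x ≢ f v → Adjacent u x → u ≡ v × x ≡ w
    only-drop {u} {x} fu≡fv fx≢fv u~x with u ≟ v
    ... | no u≢v = contradiction
      (ℤ.≤-antisym (v-max x)
        (max-spreads (isMax-≥ v-max (ℤ.≤-reflexive (sym fu≡fv))) (div≤0 dip u≢v) u~x v)) fx≢fv
    ... | yes refl with x ≟ w
    ...   | yes x≡w = refl , x≡w
    ...   | no x≢w  = contradiction (no-other-drop x≢w u~x) fx≢fv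

    -- The indicator function of the maximal set

    module _ (simple : IsSimple G) where

      cut-mult : ∀ {u x} → f u ≡ f v → f x ≢ f v → + mult u x ≡ δ v u * δ w x
      cut-mult {u} {x} fu≡fv fx≢fv with 0 ℕ.<? mult u x
      ... | yes u~x with only-drop fu≡fv fx≢fv u~x
      -- This is where simplicity enters: the only edge leaving the maximal set has multiplicity
      -- exactly 1.
      ...   | refl , refl = trans (cong +_ (ℕ.≤-antisym (simple v w) v~w))
                                  (sym (cong₂ _*_ (δ-same v) (δ-same w)))
      cut-mult {u} {x} fu≡fv fx≢fv | no u≁x =
        trans (cong +_ (ℕ.n≤0⇒n≡0 (ℕ.≮⇒≥ u≁x))) (sym not-vw)
        where
        not-vw : δ v u * δ w x ≡ 0ℤ
        not-vw with v ≟ u | w ≟ x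
        ... | no _     | _        = refl
        ... | yes _    | no _     = refl
        ... | yes refl | yes refl = contradiction v~w u≁x

      -- As `v` is a maximum of `f`, the set indicated is the one where `f` is maximal.
      top : Vertex → ℤ
      top u = if does (f u ℤ.≟ f v) then 1ℤ else 0ℤ

      -- The right side is 1 at `(v , w)`, -1 at `(w , v)` and 0 elsewhere, as befits a cut
      -- consisting of one edge. In this form `∑-δ-difference` sums it over `x`.
      top-drop : ∀ u x → + mult u x * (top u - top x) ≡ δ v u * δ w x + - δ w u * δ v x
      top-drop u x with f u ℤ.≟ f v | f x ℤ.≟ f v
      ... | yes fu | yes fx = trans (ℤ.*-zeroʳ (+ mult u x)) (sym (trans
        (cong₂ (λ a b → δ v u * a + - b * δ v x) (sink-off fx) (sink-off fu))
        (lemma (δ v u) (δ v x))))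
        where
        sink-off : ∀ {y} → f y ≡ f v → δ w y ≡ 0ℤ
        sink-off {y} fy = δ-distinct w y λ { refl → source-above-sink fy }
        lemma : ∀ a b → a * 0ℤ + - 0ℤ * b ≡ 0ℤ
        lemma = solve-∀
      ... | yes fu | no fx = trans
        (cong (_* 1ℤ) (cut-mult fu fx))
        (trans (lemma (δ v u * δ w x) (- δ w u))
          (cong (λ a → δ v u * δ w x + - δ w u * a) (sym (δ-distinct v x λ { refl → fx refl }))))
        where
        lemma : ∀ a b → a * 1ℤ ≡ a + b * 0ℤ
        lemma = solve-∀
      -- The pair crosses the cut from below, so `cut-mult` applies to it reversed.
      ... | no fu | yes fx = trans
        (cong (λ m → m * - 1ℤ) (trans (cong +_ (symmetric u x)) (cut-mult fx fu)))
        (trans (lemma (δ v x) (δ w u) (δ w x))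
          (cong (λ a → a * δ w x + - δ w u * δ v x) (sym (δ-distinct v u λ { refl → fu refl }))))
        where
        lemma : ∀ a b c → (a * b) * - 1ℤ ≡ 0ℤ * c + - b * a
        lemma = solve-∀
      ... | no fu | no fx = trans (ℤ.*-zeroʳ (+ mult u x)) (sym (trans
        (cong₂ (λ a b → a * δ w x + - δ w u * b)
          (δ-distinct v u λ { refl → fu refl }) (δ-distinct v x λ { refl → fx refl }))
        (lemma (δ w x) (- δ w u))))
        where
        lemma : ∀ a b → 0ℤ * a + b * 0ℤ ≡ 0ℤ
        lemma = solve-∀

      div-top : ∀ u → δ v u - δ w u ≡ div G top u
      div-top u = sym (trans (sum-cong-≗ (top-drop u)) (∑-δ-difference (δ v u) (δ w u) w v))

  -- From edges to all divisors of degree zero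

  difference : Vertex → Vertex → Divisor⁰ G
  difference v w = (λ u → δ v u - δ w u) , (begin
    ∑[ u < order ] (δ v u - δ w u)                 ≡⟨ sum-cong-≗ (λ u → lemma (δ v u) (δ w u)) ⟩
    ∑[ u < order ] (1ℤ * δ v u + - 1ℤ * δ w u)     ≡⟨ ∑-δ-difference 1ℤ 1ℤ v w ⟩
    0ℤ                                             ∎)
    where
    open ≡-Reasoning
    lemma : ∀ a b → a - b ≡ 1ℤ * a + - 1ℤ * b
    lemma = solve-∀

  div-∑ : ∀ {n} (c : Fin n → ℤ) (g : Fin n → Vertex → ℤ) u →
          div G (λ x → ∑[ i < n ] (c i * g i x)) u ≡ ∑[ i < n ] (c i * div G (g i) u)
  div-∑ {ℕ.zero} c g u = div-0 G u
  div-∑ {suc n}  c g u = trans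
    (div-+ G (λ x → c zero * g zero x) _ u)
    (cong₂ _+_
      (trans (sum-cong-≗ (λ x → lemma (+ mult u x) (c zero) (g zero u) (g zero x)))
             (sym (*-distribˡ-sum (c zero) (λ x → + mult u x * (g zero u - g zero x)))))
      (div-∑ (c ∘ suc) (g ∘ suc) u))
    where
    lemma : ∀ m a p q → m * (a * p - a * q) ≡ a * (m * (p - q))
    lemma = solve-∀

  -- A divisor of degree zero is the combination of the differences `v - base` with coefficients
  -- `D v`. Each difference telescopes along a path into differences across edges, and `div` is
  -- linear.
  Jac-trivial : (∀ {v w} → Adjacent v w → ∃[ h ] ∀ u → δ v u - δ w u ≡ div G h u) →
                ∀ D → _∼_ G D (𝟘 G)
  Jac-trivial edge (D , degD≡0) = (λ x → ∑[ v < order ] (D v * proj₁ (to-base v) x)) , λ u → begin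
    D u + - 0ℤ                                              ≡⟨ lemma (D u) (δ base u) ⟩
    -- The vanishing degree returns as the coefficient of `base`.
    D u - 0ℤ * δ base u                                     ≡⟨ cong (λ d → D u - d * δ base u) degD≡0 ⟨
    D u - degree G D * δ base u                             ≡⟨ expand u ⟨
    ∑[ v < order ] (D v * (δ v u - δ base u))               ≡⟨ sum-cong-≗ (λ v → cong (D v *_) (proj₂ (to-base v) u)) ⟩
    ∑[ v < order ] (D v * div G (proj₁ (to-base v)) u)      ≡⟨ div-∑ D (proj₁ ∘ to-base) u ⟨
    div G (λ x → ∑[ v < order ] (D v * proj₁ (to-base v) x)) u ∎
    where
    open ≡-Reasoning
    base : Vertex
    base = fromℕ< (ℕ.>-nonZero⁻¹ order {{nonEmpty}})
    along : ∀ {v w} → Star Adjacent v w → ∃[ h ] ∀ u → δ v u - δ w u ≡ div G h u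
    along {v} Star.ε = (λ _ → 0ℤ) , λ u → trans (ℤ.+-inverseʳ (δ v u)) (sym (div-0 G u))
    along {v} {w} (_◅_ {j = x} v~x path) with edge v~x | along path
    ... | g , g-div | h , h-div = (λ y → g y + h y) , λ u →
      trans (telescope (δ v u) (δ x u) (δ w u))
        (trans (cong₂ _+_ (g-div u) (h-div u)) (sym (div-+ G g h u)))
      where
      telescope : ∀ a b c → a - c ≡ (a - b) + (b - c)
      telescope = solve-∀
    to-base : ∀ v → ∃[ h ] ∀ u → δ v u - δ base u ≡ div G h u
    to-base v = along (connected v base)
    lemma : ∀ a b → a + - 0ℤ ≡ a - 0ℤ * b
    lemma = solve-∀
    swap : ∀ d a b → d * (a - b) ≡ d * a + - b * d
    swap = solve-∀
    expand : ∀ u → ∑[ v < order ] (D v * (δ v u - δ base u)) ≡ D u - degree G D * δ base u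
    expand u = begin
      ∑[ v < order ] (D v * (δ v u - δ base u))
        ≡⟨ sum-cong-≗ (λ v → trans (swap (D v) (δ v u) (δ base u))
             (cong (λ a → D v * a + - δ base u * D v) (δ-sym v u))) ⟩
      ∑[ v < order ] (D v * δ u v + - δ base u * D v)
        ≡⟨ ∑-distrib-+ (λ v → D v * δ u v) (λ v → - δ base u * D v) ⟩
      ∑[ v < order ] (D v * δ u v) + ∑[ v < order ] (- δ base u * D v)
        ≡⟨ cong₂ _+_ (∑-select D u) (sym (*-distribˡ-sum (- δ base u) D)) ⟩
      D u + - δ base u * degree G D
        ≡⟨ commute (D u) (δ base u) (degree G D) ⟩
      D u - degree G D * δ base u ∎
      where
      commute : ∀ a b c → a + - b * c ≡ a - c * b
      commute = solve-∀

-- Elementary abelian 2-groups and the conclusion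

two-torsion : ∀ A k → A ≅ [ℤ/2ℤ]^ k →
              let open AbelianGroup A in ∀ x → x ∙ x ≈ ε
two-torsion A k (φ , iso) x = injective λ i →
  trans (∙-homo x x i) (trans (ℙ.p+p≡0ℙ (φ x i)) (sym (ε-homo i)))
  where open GroupMorphisms.IsGroupIsomorphism iso

nontrivial : ∀ A k → A ≅ [ℤ/2ℤ]^ k → 1 ≤ k →
             let open AbelianGroup A in ¬ (∀ x → x ≈ ε)
nontrivial A k (φ , iso) 1≤k trivial = contradiction 1≡0 λ ()
  where
  open GroupMorphisms.IsGroupIsomorphism iso
  i : Fin k
  i = fromℕ< 1≤k
  1≡0 : 1ℙ ≡ 0ℙ
  -- A preimage of the constant vector `1ℙ` would be trivial; comparing images at the coordinate
  -- `i`, which exists because `1 ≤ k`, gives the contradiction.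
  1≡0 with surjective (λ _ → 1ℙ)
  ... | x , φ[≈x]≡1 = trans (sym (φ[≈x]≡1 (AbelianGroup.refl A) i))
                            (trans (⟦⟧-cong (trivial x) i) (ε-homo i))

theorem5 : ∀ (k : ℕ) → 1 ≤ k →
    ¬ (∃[ G ] (IsSimple G × Jac G ≅ [ℤ/2ℤ]^ k))
theorem5 k 1≤k (G , simple , iso) =
  nontrivial (Jac G) k iso 1≤k (Jac-trivial G edge-principal)
  where
  -- Matches the form of a dipole with the unfolded congruence of the doubled difference to `𝟘`,
  -- whence the trailing `0ℤ`.
  double : ∀ a b → + 2 * (a - b) ≡ (a - b) + (a - b) - 0ℤ
  double = solve-∀
  edge-principal : ∀ {v w} → Graph.Adjacent G v w → ∃[ h ] ∀ u → δ v u - δ w u ≡ div G h u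
  edge-principal {v} {w} v~w with two-torsion (Jac G) k iso (difference G v w)
  ... | f , f-div = top G dip v~w simple , div-top G dip v~w simple
    where
    dip : Dipole G v w f
    dip = mkDipole λ u → trans (double (δ v u) (δ w u)) (f-div u)
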